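{- Let $G$ be a simple undirected graph on vertices $\{1,\dots,n\}$ with adjacency matrix $A_G$. The polytope $P_G$ is quasi-integral; that is, the subgraph of the $1$-skeleton of $P_G$ induced by the integer points (the integer vertices) of $P_G$ is connected.
   Context: $P_G\subseteq\mathbb{R}^{n\times n}$ is the polytope of doubly stochastic matrices commuting with $A_G$: $$P_G=\Big\{P\in\mathbb{R}^{n\times n}: PA_G=A_GP,\ \sum_{i=1}^nP_{i,j}=1\ (1\le j\le n),\ \sum_{j=1}^nP_{i,j}=1\ (1\le i\le n),\ P_{i,j}\ge0\ (1\le i,j\le n)\Big\}.$$ The $1$-skeleton of a polytope is the graph whose vertices are the vertices of the polytope and whose edges are its one-dimensional faces. -}

module Defs where

open import Level using (Level; _⊔_) renaming (suc to lsuc)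
open import Algebra.Apartness.Bundles using (HeytingField)
open import Algebra.Bundles using (CommutativeRing)
open import Data.Bool.Base using (Bool; false; if_then_else_)
open import Data.Fin.Base using (Fin)
open import Data.Integer.Base using (ℤ; +_; -[1+_])
open import Data.Nat.Base as ℕ using (ℕ)
open import Data.Product.Base using (Σ; ∃; ∃-syntax; _×_; _,_; proj₁)
open import Data.Sum.Base using (_⊎_)
open import Data.Vec.Functional using (Vector)
open import Relation.Binary.Core using (Rel)
open import Relation.Binary.Structures using (IsStrictPartialOrder)
open import Relation.Binary.Construct.Closure.ReflexiveTransitive using (Star)
open import Relation.Binary.PropositionalEquality.Core using (_≡_)
open import Relation.Nullary.Negation using (¬_)
open import Relation.Unary using (Pred; _∈_)
import Algebra.Properties.Semiring.Mult as Mult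
import Algebra.Properties.Semiring.Sum as Sum

-- The real numbers, given by their axioms: an Archimedean, Cauchy-complete
-- ordered field.  Classically these axioms determine ℝ up to isomorphism.
-- They are in the constructive form (strict order, apartness, cotransitivity
-- in place of decidability) that the Cauchy reals satisfy without excluded
-- middle.
record RealNumbers c ℓ₁ ℓ₂ : Set (lsuc (c ⊔ ℓ₁ ⊔ ℓ₂)) where
  infix 4 _<_ _≤_

  field
    heytingField : HeytingField c ℓ₁ ℓ₂

  open HeytingField heytingField public

  commutativeRing : CommutativeRing c ℓ₁
  commutativeRing = record { isCommutativeRing = isCommutativeRing }

  open CommutativeRing commutativeRing public using (semiring)
  open Mult semiring public using () renaming (_×_ to _·_)
  open Sum semiring public using (sum)

  field
    _<_                  : Rel Carrier ℓ₂
    isStrictPartialOrder : IsStrictPartialOrder _≈_ _<_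
    #⇒<⊎>                : ∀ {x y} → x # y → x < y ⊎ y < x
    <⇒#                  : ∀ {x y} → x < y → x # y
    +-monoˡ-<            : ∀ z {x y} → x < y → x + z < y + z
    *-pos                : ∀ {x y} → 0# < x → 0# < y → 0# < x * y
    archimedean          : ∀ x → ∃[ k ] x < k · 1#

  -- Since m and m′ may be exchanged, the first condition says
  -- ∣ u m - u m′ ∣ < ε; similarly the second says ∣ u m - l ∣ < ε.
  IsCauchy : (ℕ → Carrier) → Set (c ⊔ ℓ₂)
  IsCauchy u = ∀ {ε} → 0# < ε →
    ∃[ N ] ∀ {m m′} → N ℕ.≤ m → N ℕ.≤ m′ → u m < u m′ + ε

  ConvergesTo : (ℕ → Carrier) → Carrier → Set (c ⊔ ℓ₂)
  ConvergesTo u l = ∀ {ε} → 0# < ε →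
    ∃[ N ] ∀ {m} → N ℕ.≤ m → u m < l + ε × l < u m + ε

  field
    complete : ∀ u → IsCauchy u → ∃[ l ] ConvergesTo u l

  -- Equivalent to "x < y or x = y" classically, and the correct reading of ≤
  -- for constructive reals.
  _≤_ : Rel Carrier ℓ₂
  x ≤ y = ¬ (y < x)

  fromℤ : ℤ → Carrier
  fromℤ (+ k)    = k · 1#
  fromℤ -[1+ k ] = - (ℕ.suc k · 1#)

record SimpleGraph (n : ℕ) : Set where
  field
    adj    : Fin n → Fin n → Bool
    symm   : ∀ i j → adj i j ≡ adj j i
    noLoop : ∀ i → adj i i ≡ false

-- Possibly infinite graphs whose vertices are taken up to an equality _≈_,
-- as is needed for vertices that are real matrices.
record Graph v ℓ e : Set (lsuc (v ⊔ ℓ ⊔ e)) where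
  field
    Vertex : Set v
    _≈_    : Rel Vertex ℓ
    Edge   : Rel Vertex e

induced : ∀ {v ℓ e p} (H : Graph v ℓ e) →
          Pred (Graph.Vertex H) p → Graph (v ⊔ p) ℓ e
induced H S = record
  { Vertex = ∃ S
  ; _≈_    = λ x y → proj₁ x ≈ proj₁ y
  ; Edge   = λ x y → Edge (proj₁ x) (proj₁ y)
  }
  where open Graph H

-- Nonempty, and any two vertices are joined by a path.  A step between
-- ≈-equal vertices does not leave the vertex.
Connected : ∀ {v ℓ e} → Graph v ℓ e → Set (v ⊔ ℓ ⊔ e)
Connected H = Vertex × (∀ x y → Star (λ u w → u ≈ w ⊎ Edge u w) x y)
  where open Graph H

module _ {c ℓ₁ ℓ₂} (ℝ : RealNumbers c ℓ₁ ℓ₂) where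
  open RealNumbers ℝ

  Matrix : ℕ → Set c
  Matrix n = Vector (Vector Carrier n) n

  private variable
    n k : ℕ
    p   : Level

  EqualMatrices : Rel (Matrix n) ℓ₁
  EqualMatrices X Y = ∀ i j → X i j ≈ Y i j

  multiply : Matrix n → Matrix n → Matrix n
  multiply X Y i j = sum (λ h → X i h * Y h j)

  -- Every linear functional on the space of matrices is X ↦ pairing C X for a
  -- unique matrix C of coefficients.
  pairing : Matrix n → Matrix n → Carrier
  pairing C X = sum (λ i → sum (λ j → C i j * X i j))

  combination : Vector Carrier k → Vector (Matrix n) k → Matrix n
  combination w B i j = sum (λ h → w h * B h i j)

  AffinelyIndependent : Vector (Matrix n) k → Set (c ⊔ ℓ₁)
  AffinelyIndependent B = ∀ w → sum w ≈ 0# →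
    (∀ i j → combination w B i j ≈ 0#) → ∀ h → w h ≈ 0#

  AffineHull : Vector (Matrix n) k → Pred (Matrix n) (c ⊔ ℓ₁)
  AffineHull B X = ∃[ w ] sum w ≈ 1# × EqualMatrices X (combination w B)

  -- The affine hull of S has dimension k: it is spanned by k + 1 affinely
  -- independent points of S.
  HasDimension : Pred (Matrix n) p → ℕ → Set (c ⊔ ℓ₁ ⊔ p)
  HasDimension {n} S k = Σ (Vector (Matrix n) (ℕ.suc k)) λ B →
    (∀ h → B h ∈ S) × AffinelyIndependent B × (∀ {X} → X ∈ S → X ∈ AffineHull B)

  -- A face of S is the set of points of S attaining equality in a linear
  -- inequality valid on S.
  record Face (S : Pred (Matrix n) p) : Set (c ⊔ ℓ₂ ⊔ p) where
    field
      normal : Matrix n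
      offset : Carrier
      valid  : ∀ {X} → X ∈ S → pairing normal X ≤ offset

  points : {S : Pred (Matrix n) p} → Face S → Pred (Matrix n) (ℓ₁ ⊔ p)
  points {S = S} F X = X ∈ S × pairing normal X ≈ offset
    where open Face F

  IsVertex : Pred (Matrix n) p → Pred (Matrix n) (c ⊔ ℓ₁ ⊔ ℓ₂ ⊔ p)
  IsVertex S X = Σ (Face S) λ F → HasDimension (points F) 0 × X ∈ points F

  IsEdge : Pred (Matrix n) p → Rel (Matrix n) (c ⊔ ℓ₁ ⊔ ℓ₂ ⊔ p)
  IsEdge S X Y = ¬ EqualMatrices X Y ×
    Σ (Face S) λ F → HasDimension (points F) 1 × X ∈ points F × Y ∈ points F

  skeleton : Pred (Matrix n) p → Graph (c ⊔ ℓ₁ ⊔ ℓ₂ ⊔ p) ℓ₁ (c ⊔ ℓ₁ ⊔ ℓ₂ ⊔ p)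
  skeleton S = record
    { Vertex = ∃ (IsVertex S)
    ; _≈_    = λ X Y → EqualMatrices (proj₁ X) (proj₁ Y)
    ; Edge   = λ X Y → IsEdge S (proj₁ X) (proj₁ Y)
    }

  IsIntegral : Pred (Matrix n) ℓ₁
  IsIntegral X = ∀ i j → ∃[ z ] X i j ≈ fromℤ z

  QuasiIntegral : Pred (Matrix n) p → Set (c ⊔ ℓ₁ ⊔ ℓ₂ ⊔ p)
  QuasiIntegral S = Connected (induced (skeleton S) (λ X → IsIntegral (proj₁ X)))

  adjacencyMatrix : SimpleGraph n → Matrix n
  adjacencyMatrix G i j = if SimpleGraph.adj G i j then 1# else 0#

  record CommutingPolytope (G : SimpleGraph n) (X : Matrix n) : Set (ℓ₁ ⊔ ℓ₂) where
    field
      commutes  : EqualMatrices (multiply X (adjacencyMatrix G))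
                                (multiply (adjacencyMatrix G) X)
      columnSum : ∀ j → sum (λ i → X i j) ≈ 1#
      rowSum    : ∀ i → sum (λ j → X i j) ≈ 1#
      nonneg    : ∀ i j → 0# ≤ X i j

{-# OPTIONS --safe #-}
-- The integral points of the polytope are the permutation matrices of the
-- automorphisms of G.  Let π and τ be automorphisms and let Z be a point
-- supported on the entries (π j , j) and (τ j , j).  By the column sums, Z is
-- given by the weights λ j = Z (τ j) j, and the remaining constraints merely
-- identify some of the weights: the row sum at π k = τ j gives λ k = λ j, and
-- commutation with A_G gives λ k = λ j whenever π k is adjacent to exactly one
-- of π j and τ j.  Hence the smallest face containing π and τ is a cube, whose
-- coordinates are the classes of the generated equivalence on which π and τ
-- differ.  Replacing π by τ on one such class gives an automorphism and moves
-- along an edge; repeating this leads from π to τ.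
module Submission where

open import Defs
open import Data.Nat.Base using (ℕ; suc; zero)

open import Level using (Level)
open import Algebra.Bundles using (CommutativeRing)
open import Data.Bool.Base using (Bool; true; false; if_then_else_)
open import Data.Bool.Properties using () renaming (_≟_ to _≟ᵇ_)
open import Data.Fin.Base using (Fin; zero; suc; punchIn; punchOut)
open import Data.Fin.Patterns using (0F; 1F)
open import Data.Fin.Permutation
  using (Permutation′; permutation; _⟨$⟩ʳ_; _⟨$⟩ˡ_; inverseˡ; inverseʳ)
  renaming (id to idₚ)
open import Data.Fin.Properties using (_≟_; any?; punchInᵢ≢i; punchIn-punchOut)
open import Data.Fin.Subset using (Subset; _∈_; _∉_; _⊂_; _⊃_; _∪_; ⁅_⁆; ⊥)
open import Data.Fin.Subset.Induction using (Acc; acc; ⊃-wellFounded)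
open import Data.Fin.Subset.Properties
  using (_∈?_; p⊆p∪q; q⊆p∪q; x∈p∪q⁻; x∈⁅x⁆; x∈⁅y⁆⇒x≡y; ∉⊥)
open import Data.Integer.Base using (+_; -[1+_])
open import Data.Product.Base using (∃; _×_; _,_; proj₁; proj₂)
open import Data.Sum.Base using (_⊎_; inj₁; inj₂; [_,_]′)
open import Data.Vec.Functional using (Vector; removeAt)
open import Function.Base using (_∘_)
open import Relation.Binary.Construct.Closure.Equivalence using (EqClosure; gfold)
open import Relation.Binary.Construct.Closure.ReflexiveTransitive using (Star; ε; _◅_; _◅◅_)
open import Relation.Binary.Construct.Closure.Symmetric using (SymClosure; fwd; bwd)
open import Relation.Binary.Core using (Rel)
open import Relation.Binary.Definitions using (Decidable)
open import Relation.Binary.PropositionalEquality as ≡ using (_≡_; _≢_)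
open import Relation.Binary.Structures using (IsStrictPartialOrder)
open import Relation.Nullary.Decidable
  using (Dec; yes; no; does; map′; ¬?; _×-dec_; _⊎-dec_; dec-true; dec-false; decidable-stable)
open import Relation.Nullary.Negation using (¬_; contradiction)
import Algebra.Apartness.Properties.HeytingCommutativeRing as HeytingProperties
import Algebra.Properties.CommutativeMonoid.Sum as CommutativeMonoidSum
import Algebra.Properties.Ring as RingProperties
import Relation.Binary.Reasoning.Setoid as SetoidReasoning

private variable
  n : ℕ
  ℓ : Level

-- Decidable reachability in a finite graph

∉⇒⊂∪⁅⁆ : {C : Subset n} {k : Fin n} → k ∉ C → C ⊂ C ∪ ⁅ k ⁆
∉⇒⊂∪⁅⁆ {C = C} {k} k∉C = p⊆p∪q ⁅ k ⁆ , k , q⊆p∪q C ⁅ k ⁆ (x∈⁅x⁆ k) , k∉C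

∈∪⁅⁆-elim : (C : Subset n) {k : Fin n} (P : Fin n → Set ℓ) →
            (∀ {j} → j ∈ C → P j) → P k → ∀ {j} → j ∈ C ∪ ⁅ k ⁆ → P j
∈∪⁅⁆-elim C {k} P onC atk j∈ with x∈p∪q⁻ C ⁅ k ⁆ j∈
... | inj₁ j∈C = onC j∈C
... | inj₂ j∈k = ≡.subst P (≡.sym (x∈⁅y⁆⇒x≡y k j∈k)) atk

module _ {S : Rel (Fin n) ℓ} (_S?_ : Decidable S) where

  -- A set of vertices reachable from i grows until no edge leaves it.
  reachable? : ∀ i (C : Subset n) → Acc _⊃_ C → i ∈ C →
               (∀ {j} → j ∈ C → Star S i j) → ∀ k → Dec (Star S i k)
  reachable? i C (acc rec) i∈C reach k
    with any? (λ j → any? (λ l → (j ∈? C) ×-dec ¬? (l ∈? C) ×-dec (j S? l)))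
  ... | yes (j , l , j∈C , l∉C , jSl) =
        reachable? i (C ∪ ⁅ l ⁆) (rec (∉⇒⊂∪⁅⁆ l∉C)) (p⊆p∪q ⁅ l ⁆ i∈C)
          (∈∪⁅⁆-elim C (Star S i) reach (reach j∈C ◅◅ jSl ◅ ε)) k
  ... | no closed = map′ reach (stays i∈C) (k ∈? C)
    where
    stays : ∀ {j l} → j ∈ C → Star S j l → l ∈ C
    stays j∈C ε = j∈C
    stays {j} j∈C (_◅_ {j = l} jSl path) = stays (decidable-stable (l ∈? C)
      (λ l∉C → closed (j , l , j∈C , l∉C , jSl))) path

  -- Makes membership in an equivalence class decidable, so that the exchange of automorphisms can
  -- be defined by cases.
  star? : Decidable (Star S)
  star? i = reachable? i ⁅ i ⁆ (⊃-wellFounded _) (x∈⁅x⁆ i)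
    (λ j∈ → ≡.subst (Star S i) (≡.sym (x∈⁅y⁆⇒x≡y i j∈)) ε)

symClosure? : {R : Rel (Fin n) ℓ} → Decidable R → Decidable (SymClosure R)
symClosure? _R?_ j k = map′ [ fwd , bwd ]′ (λ { (fwd r) → inj₁ r ; (bwd r) → inj₂ r })
  ((j R? k) ⊎-dec (k R? j))

-- Automorphisms, and exchanging one for another on a class of columns

record Automorphism (G : SimpleGraph n) : Set where
  open SimpleGraph G
  field
    perm      : Permutation′ n
    preserves : ∀ k j → adj (perm ⟨$⟩ʳ k) (perm ⟨$⟩ʳ j) ≡ adj k j

  to from : Fin n → Fin n
  to   = perm ⟨$⟩ʳ_
  from = perm ⟨$⟩ˡ_

  from-to : ∀ j → from (to j) ≡ j
  from-to j = inverseˡ perm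

  to-from : ∀ i → to (from i) ≡ i
  to-from i = inverseʳ perm

module _ {G : SimpleGraph n} where
  open SimpleGraph G
  open Automorphism

  identity : Automorphism G
  identity = record { perm = idₚ ; preserves = λ _ _ → ≡.refl }

  -- The pairs of columns whose weights are forced to agree; as `π` preserves adjacency,
  -- `adj (to π k) (to π j)` is just `adj k j`. The relation need not be symmetric, hence
  -- `EqClosure` in `Class`.
  Linked : (π τ : Automorphism G) → Rel (Fin n) _
  Linked π τ k j = to π k ≡ to τ j ⊎ adj (to π k) (to π j) ≢ adj (to π k) (to τ j)

  linked? : ∀ π τ → Decidable (Linked π τ)
  linked? π τ k j = (to π k ≟ to τ j) ⊎-dec ¬? (_ ≟ᵇ _)

  module Exchange (π τ : Automorphism G) (j₀ : Fin n) where

    Class : Fin n → Set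
    Class = EqClosure (Linked π τ) j₀

    class? : ∀ j → Dec (Class j)
    class? = star? (symClosure? (linked? π τ)) j₀

    forward : ∀ {k j} → Linked π τ k j → Class k → Class j
    forward l path = path ◅◅ fwd l ◅ ε

    backward : ∀ {k j} → Linked π τ k j → Class j → Class k
    backward l path = path ◅◅ bwd l ◅ ε

    exch exch⁻¹ : Fin n → Fin n
    exch   j = if does (class? j) then to τ j else to π j
    exch⁻¹ i = if does (class? (from τ i)) then from τ i else from π i

    exch-in : ∀ {j} → Class j → exch j ≡ to τ j
    exch-in {j} Cj rewrite dec-true (class? j) Cj = ≡.refl

    exch-out : ∀ {j} → ¬ Class j → exch j ≡ to π j
    exch-out {j} ¬Cj rewrite dec-false (class? j) ¬Cj = ≡.refl

    exch⁻¹-in : ∀ {i} → Class (from τ i) → exch⁻¹ i ≡ from τ i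
    exch⁻¹-in {i} C rewrite dec-true (class? (from τ i)) C = ≡.refl

    exch⁻¹-out : ∀ {i} → ¬ Class (from τ i) → exch⁻¹ i ≡ from π i
    exch⁻¹-out {i} ¬C rewrite dec-false (class? (from τ i)) ¬C = ≡.refl

    -- The columns in which `π` and `τ` meet row `i` lie in the class together or not at all. This
    -- is why `exch⁻¹` may test `from τ i` alone and still invert `exch`.
    same-row : ∀ i → Linked π τ (from π i) (from τ i)
    same-row i = inj₁ (≡.trans (to-from π i) (≡.sym (to-from τ i)))

    exch-exch⁻¹ : ∀ i → exch (exch⁻¹ i) ≡ i
    exch-exch⁻¹ i with class? (from τ i)
    ... | yes C = ≡.trans (exch-in C) (to-from τ i)
    ... | no ¬C = ≡.trans (exch-out (¬C ∘ forward (same-row i))) (to-from π i)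

    exch⁻¹-exch : ∀ j → exch⁻¹ (exch j) ≡ j
    exch⁻¹-exch j with class? j
    ... | yes C = ≡.trans (exch⁻¹-in (≡.subst Class (≡.sym (from-to τ j)) C)) (from-to τ j)
    ... | no ¬C = ≡.trans (exch⁻¹-out (λ C → ¬C (≡.subst Class (from-to π j)
                    (backward (same-row (to π j)) C)))) (from-to π j)

    -- Were `to π k` adjacent to exactly one of `to π j` and `to τ j`, the columns `k` and `j` would
    -- be linked and `k` would join the class.
    mixed : ∀ {k j} → ¬ Class k → Class j → adj (to π k) (to τ j) ≡ adj k j
    mixed {k} {j} ¬Ck Cj = ≡.trans
      (≡.sym (decidable-stable (_ ≟ᵇ _) (λ ne → ¬Ck (backward (inj₂ ne) Cj))))
      (preserves π k j)

    exch-preserves : ∀ k j → adj (exch k) (exch j) ≡ adj k j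
    exch-preserves k j with class? k | class? j
    ... | yes Ck | yes Cj = preserves τ k j
    -- `mixed` wants its first column outside the class; symmetry of adjacency swaps the two.
    ... | yes Ck | no ¬Cj = ≡.trans (symm _ _) (≡.trans (mixed ¬Cj Ck) (symm j k))
    ... | no ¬Ck | yes Cj = mixed ¬Ck Cj
    ... | no ¬Ck | no ¬Cj = preserves π k j

    exchanged : Automorphism G
    exchanged = record
      { perm      = permutation exch exch⁻¹ exch-exch⁻¹ exch⁻¹-exch
      ; preserves = exch-preserves
      }

    -- `τ` enters a link only through its value at the second column, and there `exch` equals `τ`.
    exchanged-linked : ∀ {k j} → Class j → Linked π τ k j → Linked π exchanged k j
    exchanged-linked {k} Cj =
      ≡.subst (λ t → to π k ≡ t ⊎ adj (to π k) _ ≢ adj (to π k) t) (≡.sym (exch-in Cj))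

    -- A path starting in the class never leaves it, so each of its links survives the replacement
    -- of `τ` by `exchanged`.
    exchanged-path : ∀ {k j} → Class k → EqClosure (Linked π τ) k j →
                     EqClosure (Linked π exchanged) k j
    exchanged-path Ck ε = ε
    exchanged-path Ck (fwd l ◅ path) =
      fwd (exchanged-linked (forward l Ck) l) ◅ exchanged-path (forward l Ck) path
    exchanged-path Ck (bwd l ◅ path) =
      bwd (exchanged-linked Ck l) ◅ exchanged-path (backward l Ck) path

    -- The columns where `π` and `exchanged` differ form part of one class of their own links, which
    -- is what makes the pair an edge.
    differ⇒linked : ∀ j → to π j ≢ exch j → EqClosure (Linked π exchanged) j₀ j
    differ⇒linked j ne = exchanged-path ε
      (decidable-stable (class? j) (λ ¬Cj → ne (≡.sym (exch-out ¬Cj))))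

    -- An exchange never destroys agreement with `τ`; the recursion in `path` relies on this.
    exch-agrees : ∀ {j} → to π j ≡ to τ j → exch j ≡ to τ j
    exch-agrees {j} eq with class? j
    ... | yes _ = ≡.refl
    ... | no  _ = eq

module _ {c ℓ₁ ℓ₂} (ℝ : RealNumbers c ℓ₁ ℓ₂) where
  open RealNumbers ℝ hiding (zero)
  open CommutativeRing commutativeRing using (ring; +-commutativeMonoid)
  open RingProperties ring
    using (-‿distribˡ-*; -‿+-comm; -0#≈0#; -‿involutive; -‿injective; +-cancelˡ; +-cancelʳ)
  open CommutativeMonoidSum +-commutativeMonoid
    using (sum-remove; ∑-distrib-+; sum-cong-≋; sum-replicate-zero)
  open HeytingProperties heytingCommutativeRing using (1#0)
  open IsStrictPartialOrder isStrictPartialOrder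
    using (<-resp-≈) renaming (irrefl to <-irrefl; trans to <-trans)
  open SetoidReasoning setoid

  -- Order in a constructive ordered field

  <-cong : ∀ {x x′ y y′} → x ≈ x′ → y ≈ y′ → x < y → x′ < y′
  <-cong x≈ y≈ = proj₂ <-resp-≈ x≈ ∘ proj₁ <-resp-≈ y≈

  -- Cotransitivity of `<`, inherited from apartness: the constructive substitute for trichotomy.
  <-compare : ∀ {x y} → x < y → ∀ z → x < z ⊎ z < y
  <-compare x<y z with #-cotrans (<⇒# x<y) z
  ... | inj₁ x#z = [ inj₁ , (λ z<x → inj₂ (<-trans z<x x<y)) ]′ (#⇒<⊎> x#z)
  ... | inj₂ z#y = [ inj₂ , (λ y<z → inj₁ (<-trans x<y y<z)) ]′ (#⇒<⊎> z#y)

  -- Apartness is tight, and the two negations together refute `x # y`.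
  ≤-antisym : ∀ {x y} → x ≤ y → y ≤ x → x ≈ y
  ≤-antisym x≤y y≤x = proj₁ (tight _ _) ([ y≤x , x≤y ]′ ∘ #⇒<⊎>)

  +-monoʳ-< : ∀ z {x y} → x < y → z + x < z + y
  +-monoʳ-< z x<y = <-cong (+-comm _ _) (+-comm _ _) (+-monoˡ-< z x<y)

  +-cancelˡ-< : ∀ z {x y} → z + x < z + y → x < y
  +-cancelˡ-< z lt = <-cong cancel cancel (+-monoʳ-< (- z) lt)
    where
    cancel : ∀ {x} → - z + (z + x) ≈ x
    cancel {x} = begin
      - z + (z + x) ≈⟨ +-assoc _ _ _ ⟨
      - z + z + x   ≈⟨ +-congʳ (-‿inverseˡ z) ⟩
      0# + x        ≈⟨ +-identityˡ x ⟩
      x             ∎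

  neg-pos : ∀ {x} → 0# < x → - x < 0#
  neg-pos {x} 0<x = <-cong (+-identityʳ _) (-‿inverseˡ x) (+-monoʳ-< (- x) 0<x)

  neg-pos⁻¹ : ∀ {x} → 0# < - x → x < 0#
  neg-pos⁻¹ {x} 0<-x = <-cong (+-identityʳ _) (-‿inverseʳ x) (+-monoʳ-< x 0<-x)

  0<1 : 0# < 1#
  0<1 with #⇒<⊎> 1#0
  ... | inj₂ lt = lt
  -- If `1# < 0#`, then `- 1#` is positive, and so is its square `1#`.
  ... | inj₁ 1<0 = contradiction (<-trans 0<1′ 1<0) (<-irrefl refl)
    where
    0<-1 : 0# < - 1#
    0<-1 = <-cong (-‿inverseʳ 1#) (+-identityˡ _) (+-monoˡ-< (- 1#) 1<0)

    0<1′ : 0# < 1#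
    0<1′ = <-cong refl (begin
      - 1# * - 1#   ≈⟨ -‿distribˡ-* _ _ ⟨
      - (1# * - 1#) ≈⟨ -‿cong (*-identityˡ _) ⟩
      - - 1#        ≈⟨ -‿involutive 1# ⟩
      1#            ∎) (*-pos 0<-1 0<-1)

  1≉0 : ¬ 1# ≈ 0#
  1≉0 1≈0 = <-irrefl (sym 1≈0) 0<1

  0<suc : ∀ k → 0# < suc k · 1#
  0<suc zero    = <-cong refl (sym (+-identityʳ 1#)) 0<1
  0<suc (suc k) = <-trans 0<1 (<-cong (+-identityʳ 1#) refl (+-monoʳ-< 1# (0<suc k)))

  +-nonneg : ∀ {x y} → 0# ≤ x → 0# ≤ y → 0# ≤ x + y
  -- Comparing `x` with `x + y < 0#` gives `x < 0#` or `x + y < x`, and the latter means `y < 0#`.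
  +-nonneg {x} {y} 0≤x 0≤y x+y<0 with <-compare x+y<0 x
  ... | inj₂ x<0   = 0≤x x<0
  ... | inj₁ x+y<x = 0≤y (+-cancelˡ-< x (<-cong refl (sym (+-identityʳ x)) x+y<x))

  +-nonneg-zeroˡ : ∀ {x y} → 0# ≤ x → 0# ≤ y → x + y ≈ 0# → x ≈ 0#
  +-nonneg-zeroˡ {x} {y} 0≤x 0≤y x+y≈0 = ≤-antisym
    (λ 0<x → 0≤y (<-cong (+-identityˡ y) x+y≈0 (+-monoˡ-< y 0<x))) 0≤x

  -- Finite sums and standard basis vectors

  sum-nonneg : (f : Vector Carrier n) → (∀ i → 0# ≤ f i) → 0# ≤ sum f
  sum-nonneg {zero}  f 0≤f = <-irrefl refl
  sum-nonneg {suc n} f 0≤f = +-nonneg (0≤f zero) (sum-nonneg (f ∘ suc) (0≤f ∘ suc))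

  sum-nonneg-zero : (f : Vector Carrier n) → (∀ i → 0# ≤ f i) → sum f ≈ 0# → ∀ i → f i ≈ 0#
  sum-nonneg-zero f 0≤f Σ≈0 zero =
    +-nonneg-zeroˡ (0≤f zero) (sum-nonneg (f ∘ suc) (0≤f ∘ suc)) Σ≈0
  sum-nonneg-zero f 0≤f Σ≈0 (suc i) =
    sum-nonneg-zero (f ∘ suc) (0≤f ∘ suc)
      (+-nonneg-zeroˡ (sum-nonneg (f ∘ suc) (0≤f ∘ suc)) (0≤f zero)
        (trans (+-comm _ _) Σ≈0)) i

  entry≤sum : (f : Vector Carrier n) → (∀ i → 0# ≤ f i) → ∀ a → f a ≤ sum f
  entry≤sum {suc n} f 0≤f a Σ<fa = sum-nonneg (removeAt f a) (0≤f ∘ punchIn a)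
    (+-cancelˡ-< (f a) (<-cong (sum-remove {i = a} f) (sym (+-identityʳ (f a))) Σ<fa))

  sum-zero : (f : Vector Carrier n) → (∀ i → f i ≈ 0#) → sum f ≈ 0#
  sum-zero {n} f f≈0 = trans (sum-cong-≋ f≈0) (sum-replicate-zero n)

  sum-neg : (f : Vector Carrier n) → sum (λ i → - f i) ≈ - sum f
  sum-neg {zero}  f = sym -0#≈0#
  sum-neg {suc n} f = trans (+-congˡ (sum-neg (f ∘ suc))) (-‿+-comm _ _)

  sum-single : (f : Vector Carrier n) (a : Fin n) → (∀ i → i ≢ a → f i ≈ 0#) → sum f ≈ f a
  sum-single {suc n} f a off = begin
    sum f                      ≈⟨ sum-remove {i = a} f ⟩
    f a + sum (removeAt f a)   ≈⟨ +-congˡ (sum-zero (removeAt f a) (λ i → off _ (punchInᵢ≢i a i))) ⟩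
    f a + 0#                   ≈⟨ +-identityʳ _ ⟩
    f a                        ∎

  -- Being a standard basis vector is stated as a property, so that it covers rows and columns of
  -- permutation matrices and of arbitrary integral points alike.
  UnitAt : Vector Carrier n → Fin n → Set _
  UnitAt g a = g a ≈ 1# × (∀ h → h ≢ a → g h ≈ 0#)

  sum-unit : {g : Vector Carrier n} {a : Fin n} → UnitAt g a → sum g ≈ 1#
  sum-unit {g = g} {a} (one , off) = trans (sum-single g a off) one

  sum-select : (f : Vector Carrier n) {g : Vector Carrier n} {a : Fin n} →
               UnitAt g a → sum (λ h → f h * g h) ≈ f a
  sum-select f {g} {a} (one , off) = begin
    sum (λ h → f h * g h) ≈⟨ sum-single _ a (λ h h≢a → trans (*-congˡ (off h h≢a)) (zeroʳ _)) ⟩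
    f a * g a             ≈⟨ *-congˡ one ⟩
    f a * 1#              ≈⟨ *-identityʳ _ ⟩
    f a                   ∎

  -- The coefficients `p` and `q` vary with the index because a row of a point meets columns of
  -- different weights; along a column they are constant.
  sum-two : ∀ {n} {v p q g g′ : Vector Carrier n} (f : Vector Carrier n) {a b : Fin n} →
            UnitAt g a → UnitAt g′ b → (∀ h → v h ≈ p h * g h + q h * g′ h) →
            sum (λ h → f h * v h) ≈ f a * p a + f b * q b
  sum-two {n} {v} {p} {q} {g} {g′} f {a} {b} unit unit′ v≈ = begin
    sum (λ h → f h * v h)                               ≈⟨ sum-cong-≋ expand ⟩
    sum (λ h → f h * p h * g h + f h * q h * g′ h)      ≈⟨ ∑-distrib-+ {n} _ _ ⟩
    sum (λ h → f h * p h * g h) + sum (λ h → f h * q h * g′ h)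
      ≈⟨ +-cong (sum-select (λ h → f h * p h) unit) (sum-select (λ h → f h * q h) unit′) ⟩
    f a * p a + f b * q b ∎
    where
    expand : ∀ h → f h * v h ≈ f h * p h * g h + f h * q h * g′ h
    expand h = begin
      f h * v h                             ≈⟨ *-congˡ (v≈ h) ⟩
      f h * (p h * g h + q h * g′ h)        ≈⟨ distribˡ _ _ _ ⟩
      f h * (p h * g h) + f h * (q h * g′ h) ≈⟨ +-cong (*-assoc _ _ _) (*-assoc _ _ _) ⟨
      f h * p h * g h + f h * q h * g′ h    ∎

  -- Kronecker deltas and vectors supported at two places

  indicator : Bool → Carrier
  indicator b = if b then 1# else 0#

  indicator-nonneg : ∀ b → 0# ≤ indicator b
  indicator-nonneg true  1<0 = <-irrefl refl (<-trans 0<1 1<0)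
  indicator-nonneg false     = <-irrefl refl

  indicator-injective : ∀ {b b′} → indicator b ≈ indicator b′ → b ≡ b′
  indicator-injective {true}  {true}  _  = ≡.refl
  indicator-injective {true}  {false} eq = contradiction eq 1≉0
  indicator-injective {false} {true}  eq = contradiction (sym eq) 1≉0
  indicator-injective {false} {false} _  = ≡.refl

  δ : Fin n → Fin n → Carrier
  δ i j = indicator (does (i ≟ j))

  δ-equal : {i j : Fin n} → i ≡ j → δ i j ≈ 1#
  δ-equal {i = i} {j} i≡j rewrite dec-true (i ≟ j) i≡j = refl

  δ-distinct : {i j : Fin n} → i ≢ j → δ i j ≈ 0#
  δ-distinct {i = i} {j} i≢j rewrite dec-false (i ≟ j) i≢j = refl

  δ-unit : (a : Fin n) → UnitAt (λ i → δ i a) a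
  δ-unit a = δ-equal {i = a} ≡.refl , λ _ → δ-distinct

  δ-nonneg : (i j : Fin n) → 0# ≤ δ i j
  δ-nonneg i j = indicator-nonneg _

  affine : ∀ x d → (1# + - x) * d + x * d ≈ d
  affine x d = begin
    (1# + - x) * d + x * d ≈⟨ distribʳ _ _ _ ⟨
    (1# + - x + x) * d     ≈⟨ *-congʳ (+-assoc _ _ _) ⟩
    (1# + (- x + x)) * d   ≈⟨ *-congʳ (+-congˡ (-‿inverseˡ x)) ⟩
    (1# + 0#) * d          ≈⟨ *-congʳ (+-identityʳ _) ⟩
    1# * d                 ≈⟨ *-identityˡ d ⟩
    d                      ∎

  -- Subtracting v b from the entry at b leaves a vector supported at a only,
  -- so a = b needs no separate treatment.
  two-point-support : (v : Vector Carrier n) (a b : Fin n) → sum v ≈ 1# →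
                      (∀ i → i ≢ a → i ≢ b → v i ≈ 0#) →
                      ∀ i → v i ≈ (1# + - v b) * δ i a + v b * δ i b
  two-point-support v a b Σv≈1 off i = begin
    v i                                     ≈⟨ +-identityʳ _ ⟨
    v i + 0#                                ≈⟨ +-congˡ neg-inverse ⟨
    v i + (- v b * δ i b + v b * δ i b)     ≈⟨ +-assoc _ _ _ ⟨
    u i + v b * δ i b                       ≈⟨ +-congʳ (u-form i) ⟩
    (1# + - v b) * δ i a + v b * δ i b      ∎
    where
    neg-inverse : - v b * δ i b + v b * δ i b ≈ 0#
    neg-inverse = trans (sym (distribʳ _ _ _)) (trans (*-congʳ (-‿inverseˡ _)) (zeroˡ _))

    u : Vector Carrier _
    u h = v h + - v b * δ h b

    u-off : ∀ h → h ≢ a → u h ≈ 0#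
    u-off h h≢a with h ≟ b
    ... | yes ≡.refl = trans (+-congˡ (*-identityʳ _)) (-‿inverseʳ _)
    ... | no h≢b = trans (+-cong (off h h≢a h≢b) (zeroʳ _)) (+-identityˡ _)

    u-at : u a ≈ 1# + - v b
    u-at = begin
      u a                                 ≈⟨ sum-single u a u-off ⟨
      sum u                               ≈⟨ ∑-distrib-+ v _ ⟩
      sum v + sum (λ h → - v b * δ h b)   ≈⟨ +-cong Σv≈1 (sum-select (λ _ → - v b) (δ-unit b)) ⟩
      1# + - v b                          ∎

    u-form : ∀ h → u h ≈ (1# + - v b) * δ h a
    u-form h with h ≟ a
    ... | yes ≡.refl = trans u-at (sym (*-identityʳ _))
    ... | no h≢a = trans (u-off h h≢a) (sym (zeroʳ _))

  -- Integral stochastic vectors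

  integral-in-unit-interval : ∀ {x} → ∃ (λ z → x ≈ fromℤ z) → 0# ≤ x → x ≤ 1# → x ≈ 0# ⊎ x ≈ 1#
  integral-in-unit-interval (+ zero , x≈z) 0≤x x≤1 = inj₁ x≈z
  integral-in-unit-interval (+ suc zero , x≈z) 0≤x x≤1 = inj₂ (trans x≈z (+-identityʳ 1#))
  integral-in-unit-interval (+ suc (suc k) , x≈z) 0≤x x≤1 =
    contradiction (<-cong (+-identityʳ 1#) (sym x≈z) (+-monoʳ-< 1# (0<suc k))) x≤1
  integral-in-unit-interval (-[1+ k ] , x≈z) 0≤x x≤1 =
    contradiction (<-cong (sym x≈z) refl (neg-pos (0<suc k))) 0≤x

  -- Each entry is 0 or 1. Not all are 0, since the sum is 1; a single 1 exhausts the sum and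
  -- nonnegativity kills the rest.
  integral-stochastic⇒unit : (v : Vector Carrier n) → (∀ i → ∃ λ z → v i ≈ fromℤ z) →
                             (∀ i → 0# ≤ v i) → sum v ≈ 1# → ∃ (UnitAt v)
  integral-stochastic⇒unit {n} v integral 0≤v Σv≈1 = find (any? one?)
    where
    digit : ∀ i → v i ≈ 0# ⊎ v i ≈ 1#
    digit i = integral-in-unit-interval (integral i) (0≤v i)
      (λ 1<vi → entry≤sum v 0≤v i (<-cong (sym Σv≈1) refl 1<vi))

    -- Equality in the field is not assumed decidable; it is decided here because the entry is known
    -- to be 0 or 1.
    one? : ∀ i → Dec (v i ≈ 1#)
    one? i = [ (λ vi≈0 → no (λ vi≈1 → 1≉0 (trans (sym vi≈1) vi≈0))) , yes ]′ (digit i)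

    off-zero : ∀ {m} (w : Vector Carrier m) → (∀ i → 0# ≤ w i) → sum w ≈ 1# →
               ∀ a → w a ≈ 1# → ∀ h → h ≢ a → w h ≈ 0#
    off-zero {suc m} w 0≤w Σw≈1 a wa≈1 h h≢a =
      ≡.subst (λ h → w h ≈ 0#) (punchIn-punchOut (h≢a ∘ ≡.sym))
        (sum-nonneg-zero (removeAt w a) (0≤w ∘ punchIn a) rest≈0 (punchOut (h≢a ∘ ≡.sym)))
      where
      rest≈0 : sum (removeAt w a) ≈ 0#
      rest≈0 = +-cancelˡ 1# _ _ (begin
        1# + sum (removeAt w a)  ≈⟨ +-congʳ wa≈1 ⟨
        w a + sum (removeAt w a) ≈⟨ sum-remove {i = a} w ⟨
        sum w                    ≈⟨ Σw≈1 ⟩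
        1#                       ≈⟨ +-identityʳ 1# ⟨
        1# + 0#                  ∎)

    find : Dec (∃ λ i → v i ≈ 1#) → ∃ (UnitAt v)
    find (yes (a , va≈1)) = a , va≈1 , off-zero v 0≤v Σv≈1 a va≈1
    find (no none) = contradiction (trans (sym Σv≈1) (sum-zero v λ i →
      [ (λ e → e) , (λ e → contradiction (i , e) none) ]′ (digit i))) 1≉0

  pairing-neg : (M X : Matrix ℝ n) →
                pairing ℝ (λ i j → - M i j) X ≈ - pairing ℝ M X
  pairing-neg {n} M X = trans
    (sum-cong-≋ {n} (λ i → trans
      (sum-cong-≋ {n} (λ j → sym (-‿distribˡ-* (M i j) (X i j)))) (sum-neg {n} _)))
    (sum-neg {n} _)

  module _ {n : ℕ} {G : SimpleGraph n} where
    open SimpleGraph G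
    open Automorphism
    open CommutingPolytope

    private
      A : Matrix ℝ n
      A = adjacencyMatrix ℝ G

      P : Matrix ℝ n → Set _
      P = CommutingPolytope ℝ G

    -- Integral points of the polytope are automorphisms

    permutationMatrix : Automorphism G → Matrix ℝ n
    permutationMatrix π i j = δ i (to π j)

    column-unit : ∀ π j → UnitAt (λ i → permutationMatrix π i j) (to π j)
    column-unit π j = δ-unit (to π j)

    row-unit : ∀ π i → UnitAt (permutationMatrix π i) (from π i)
    row-unit π i = δ-equal (≡.sym (to-from π i)) ,
      λ h h≢ → δ-distinct λ i≡ → h≢ (≡.trans (≡.sym (from-to π h)) (≡.cong (from π) (≡.sym i≡)))

    adj-from : ∀ (π : Automorphism G) i j → adj (from π i) j ≡ adj i (to π j)
    adj-from π i j = ≡.trans (≡.sym (preserves π (from π i) j))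
      (≡.cong (λ t → adj t (to π j)) (to-from π i))

    permutationMatrix∈P : ∀ π → P (permutationMatrix π)
    permutationMatrix∈P π = record
      { commutes  = λ i j → begin
          sum (λ h → δ i (to π h) * A h j) ≈⟨ sum-cong-≋ {n} (λ h → *-comm _ _) ⟩
          sum (λ h → A h j * δ i (to π h)) ≈⟨ sum-select (λ h → A h j) (row-unit π i) ⟩
          A (from π i) j                   ≡⟨ ≡.cong indicator (adj-from π i j) ⟩
          A i (to π j)                     ≈⟨ sum-select (A i) (column-unit π j) ⟨
          sum (λ h → A i h * δ h (to π j)) ∎
      ; columnSum = λ j → sum-unit (column-unit π j)
      ; rowSum    = λ i → sum-unit (row-unit π i)
      ; nonneg    = λ i j → δ-nonneg i (to π j)
      }

    permutationMatrix-integral : ∀ π → IsIntegral ℝ (permutationMatrix π)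
    permutationMatrix-integral π i j with i ≟ to π j
    ... | yes _ = + 1 , sym (+-identityʳ 1#)
    ... | no  _ = + 0 , refl

    -- Rows and columns of `X` are standard basis vectors; the positions of their ones give mutually
    -- inverse maps, and commutation says that these preserve adjacency.
    integral⇒automorphism : ∀ {X} → P X → IsIntegral ℝ X →
                            ∃ λ π → EqualMatrices ℝ X (permutationMatrix π)
    integral⇒automorphism {X} X∈P integral = record
      { perm      = permutation σ σ⁻¹ σ-σ⁻¹ σ⁻¹-σ
      ; preserves = σ-preserves
      } , X≈
      where
      column : ∀ j → ∃ (UnitAt (λ i → X i j))
      column j = integral-stochastic⇒unit (λ i → X i j) (λ i → integral i j)
        (λ i → nonneg X∈P i j) (columnSum X∈P j)

      row : ∀ i → ∃ (UnitAt (X i))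
      row i = integral-stochastic⇒unit (X i) (integral i) (nonneg X∈P i) (rowSum X∈P i)

      σ σ⁻¹ : Fin n → Fin n
      σ   j = proj₁ (column j)
      σ⁻¹ i = proj₁ (row i)

      σ-σ⁻¹ : ∀ i → σ (σ⁻¹ i) ≡ i
      -- Otherwise the entry at row `i` and column `σ⁻¹ i` is 1 by its row and 0 by its column.
      σ-σ⁻¹ i = decidable-stable (_ ≟ _) λ ne → 1≉0 (trans
        (sym (proj₁ (proj₂ (row i)))) (proj₂ (proj₂ (column (σ⁻¹ i))) i (ne ∘ ≡.sym)))

      σ⁻¹-σ : ∀ j → σ⁻¹ (σ j) ≡ j
      σ⁻¹-σ j = decidable-stable (_ ≟ _) λ ne → 1≉0 (trans
        (sym (proj₁ (proj₂ (column j)))) (proj₂ (proj₂ (row (σ j))) j (ne ∘ ≡.sym)))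

      X≈ : ∀ i j → X i j ≈ δ i (σ j)
      X≈ i j with i ≟ σ j
      ... | yes ≡.refl = proj₁ (proj₂ (column j))
      ... | no  i≢     = proj₂ (proj₂ (column j)) i i≢

      σ-preserves : ∀ k j → adj (σ k) (σ j) ≡ adj k j
      -- Compare the two products at row `σ k` and column `j`.
      σ-preserves k j = indicator-injective (begin
        A (σ k) (σ j)                ≈⟨ sum-select (A (σ k)) (proj₂ (column j)) ⟨
        multiply ℝ A X (σ k) j       ≈⟨ commutes X∈P (σ k) j ⟨
        multiply ℝ X A (σ k) j       ≈⟨ sum-cong-≋ {n} (λ h → *-comm _ _) ⟩
        sum (λ h → A h j * X (σ k) h) ≈⟨ sum-select (λ h → A h j) (proj₂ (row (σ k))) ⟩
        A (σ⁻¹ (σ k)) j              ≡⟨ ≡.cong (λ t → A t j) (σ⁻¹-σ k) ⟩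
        A k j                        ∎)

    -- Faces cut out by the vanishing of prescribed entries

    module _ (M : Fin n → Fin n → Bool) where

      mask : Matrix ℝ n
      mask i j = indicator (M i j)

      masked-nonneg : ∀ {X} → P X → ∀ i j → 0# ≤ mask i j * X i j
      masked-nonneg X∈P i j lt with M i j
      ... | true  = nonneg X∈P i j (<-cong (*-identityˡ _) refl lt)
      ... | false = <-irrefl (zeroˡ _) lt

      -- A face is bounded from above, so the mask is negated. The masked terms are nonnegative, so
      -- equality holds exactly when every masked entry vanishes.
      maskFace : Face ℝ P
      maskFace = record
        { normal = λ i j → - mask i j
        ; offset = 0#
        ; valid  = λ {X} X∈P 0<p →
            sum-nonneg _ (λ i → sum-nonneg _ (masked-nonneg X∈P i))
              (neg-pos⁻¹ (<-cong refl (pairing-neg mask X) 0<p))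
        }

      maskFace-vanishes : ∀ {X} → points ℝ maskFace X → ∀ i j → M i j ≡ true → X i j ≈ 0#
      maskFace-vanishes {X} (X∈P , p≈0) i j Mij = begin
        X i j             ≈⟨ *-identityˡ _ ⟨
        1# * X i j        ≡⟨ ≡.cong (λ b → indicator b * X i j) Mij ⟨
        mask i j * X i j  ≈⟨ sum-nonneg-zero _ (masked-nonneg X∈P i) row≈0 j ⟩
        0#                ∎
        where
        row≈0 = sum-nonneg-zero _ (λ i → sum-nonneg _ (masked-nonneg X∈P i))
          (-‿injective (trans (sym (pairing-neg mask X)) (trans p≈0 (sym -0#≈0#)))) i

      vanishes⇒maskFace : ∀ {X} → P X → (∀ i j → M i j ≡ true → X i j ≈ 0#) →
                          points ℝ maskFace X
      vanishes⇒maskFace {X} X∈P vanish = X∈P , trans (pairing-neg mask X)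
        (trans (-‿cong (sum-zero _ (λ i → sum-zero _ (term i)))) -0#≈0#)
        where
        term : ∀ i j → mask i j * X i j ≈ 0#
        term i j with M i j in eq
        ... | true  = trans (*-congˡ (vanish i j eq)) (zeroʳ _)
        ... | false = zeroˡ _

    -- The face spanned by two automorphisms

    module Span (π τ : Automorphism G) where

      offSupport : Fin n → Fin n → Bool
      offSupport i j = does (¬? (i ≟ to π j) ×-dec ¬? (i ≟ to τ j))

      face : Face ℝ P
      face = maskFace offSupport

      face-left : points ℝ face (permutationMatrix π)
      face-left = vanishes⇒maskFace offSupport (permutationMatrix∈P π) vanish
        where
        vanish : ∀ i j → offSupport i j ≡ true → δ i (to π j) ≈ 0#
        vanish i j off with i ≟ to π j
        -- In the `yes` case `offSupport i j` computes to `false`.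
        ... | no _ = refl

      face-right : points ℝ face (permutationMatrix τ)
      face-right = vanishes⇒maskFace offSupport (permutationMatrix∈P τ) vanish
        where
        vanish : ∀ i j → offSupport i j ≡ true → δ i (to τ j) ≈ 0#
        vanish i j off with i ≟ to π j | i ≟ to τ j
        ... | no _ | no _ = refl

      module _ {Z : Matrix ℝ n} (Z∈F : points ℝ face Z) where

        weight : Fin n → Carrier
        weight j = Z (to τ j) j

        -- Column `j` sums to 1 and has support in two places, so one weight determines it; this
        -- includes columns with `to π j ≡ to τ j`.
        entries : ∀ i j → Z i j ≈ (1# + - weight j) * permutationMatrix π i j
                                  + weight j * permutationMatrix τ i j
        entries i j = two-point-support (λ i → Z i j) (to π j) (to τ j)
          (columnSum (proj₁ Z∈F) j)
          (λ i i≢π i≢τ → maskFace-vanishes offSupport Z∈F i j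
            (dec-true (¬? (i ≟ to π j) ×-dec ¬? (i ≟ to τ j)) (i≢π , i≢τ))) i

        row-combination : ∀ f i → sum (λ h → f h * Z i h) ≈
          f (from π i) * (1# + - weight (from π i)) + f (from τ i) * weight (from τ i)
        row-combination f i = sum-two {p = λ h → 1# + - weight h} {q = weight} f
          (row-unit π i) (row-unit τ i) (entries i)

        column-combination : ∀ f j → sum (λ h → f h * Z h j) ≈
          f (to π j) * (1# + - weight j) + f (to τ j) * weight j
        column-combination f j = sum-two {p = λ _ → 1# + - weight j} {q = λ _ → weight j} f
          (column-unit π j) (column-unit τ j) (λ i → entries i j)

        -- Row `i` receives one minus the first weight from its `π` entry and the second weight from
        -- its `τ` entry, and these add up to 1.
        row-weights : ∀ i → weight (from π i) ≈ weight (from τ i)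
        row-weights i = -‿injective (+-cancelˡ 1# _ _ (+-cancelʳ (weight l) _ _ (begin
          1# + - weight k + weight l               ≈⟨ +-cong (*-identityˡ _) (*-identityˡ _) ⟨
          1# * (1# + - weight k) + 1# * weight l   ≈⟨ row-combination (λ _ → 1#) i ⟨
          sum (λ h → 1# * Z i h)                   ≈⟨ sum-cong-≋ {n} (λ h → *-identityˡ _) ⟩
          sum (Z i)                                ≈⟨ rowSum (proj₁ Z∈F) i ⟩
          1#                                       ≈⟨ +-identityʳ 1# ⟨
          1# + 0#                                  ≈⟨ +-congˡ (-‿inverseˡ _) ⟨
          1# + (- weight l + weight l)             ≈⟨ +-assoc _ _ _ ⟨
          1# + - weight l + weight l               ∎)))
          where
          k = from π i
          l = from τ i

        -- Commutation at `(i , j)`, with `row-weights` used to write the left side in a single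
        -- weight: both sides become the same affine function, at two weights.
        commuting-weights : ∀ i j →
          A i (to π j) * (1# + - weight (from π i)) + A i (to τ j) * weight (from π i) ≈
          A i (to π j) * (1# + - weight j) + A i (to τ j) * weight j
        commuting-weights i j = begin
          A i (to π j) * (1# + - weight k) + A i (to τ j) * weight k
            ≈⟨ +-congˡ (*-congˡ (row-weights i)) ⟩
          A i (to π j) * (1# + - weight k) + A i (to τ j) * weight l
            ≡⟨ ≡.cong₂ (λ b b′ → indicator b * (1# + - weight k) + indicator b′ * weight l)
                 (adj-from π i j) (adj-from τ i j) ⟨
          A k j * (1# + - weight k) + A l j * weight l ≈⟨ row-combination (λ h → A h j) i ⟨
          sum (λ h → A h j * Z i h)                    ≈⟨ sum-cong-≋ {n} (λ h → *-comm _ _) ⟩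
          multiply ℝ Z A i j                           ≈⟨ commutes (proj₁ Z∈F) i j ⟩
          multiply ℝ A Z i j                           ≈⟨ column-combination (A i) j ⟩
          A i (to π j) * (1# + - weight j) + A i (to τ j) * weight j ∎
          where
          k = from π i
          l = from τ i

        -- For distinct truth values the affine function has slope 1 or -1, hence is injective.
        distinct-coefficients : ∀ b b′ → b ≢ b′ → ∀ x y →
          indicator b * (1# + - x) + indicator b′ * x ≈
          indicator b * (1# + - y) + indicator b′ * y → x ≈ y
        distinct-coefficients true  true  ne x y eq = contradiction ≡.refl ne
        distinct-coefficients false false ne x y eq = contradiction ≡.refl ne
        distinct-coefficients true  false ne x y eq = -‿injective (+-cancelˡ 1# _ _ (begin
          1# + - x                    ≈⟨ drop x ⟨
          1# * (1# + - x) + 0# * x    ≈⟨ eq ⟩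
          1# * (1# + - y) + 0# * y    ≈⟨ drop y ⟩
          1# + - y                    ∎))
          where
          drop : ∀ z → 1# * (1# + - z) + 0# * z ≈ 1# + - z
          drop z = trans (+-cong (*-identityˡ _) (zeroˡ _)) (+-identityʳ _)
        distinct-coefficients false true  ne x y eq = begin
          x                           ≈⟨ drop x ⟨
          0# * (1# + - x) + 1# * x    ≈⟨ eq ⟩
          0# * (1# + - y) + 1# * y    ≈⟨ drop y ⟩
          y                           ∎
          where
          drop : ∀ z → 0# * (1# + - z) + 1# * z ≈ z
          drop z = trans (+-cong (zeroˡ _) (*-identityˡ _)) (+-identityˡ _)

        linked-weights : ∀ {k j} → Linked π τ k j → weight k ≈ weight j
        -- Both cases look at row `to π k`, whose `π` entry lies in column `k`.
        linked-weights {k} {j} (inj₁ πk≡τj) = begin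
          weight k                 ≡⟨ ≡.cong weight (from-to π k) ⟨
          weight (from π (to π k)) ≈⟨ row-weights (to π k) ⟩
          weight (from τ (to π k)) ≡⟨ ≡.cong (λ i → weight (from τ i)) πk≡τj ⟩
          weight (from τ (to τ j)) ≡⟨ ≡.cong weight (from-to τ j) ⟩
          weight j                 ∎
        linked-weights {k} {j} (inj₂ ne) = begin
          weight k                 ≡⟨ ≡.cong weight (from-to π k) ⟨
          weight (from π (to π k)) ≈⟨ distinct-coefficients _ _ ne _ _ (commuting-weights (to π k) j) ⟩
          weight j                 ∎

        path-weights : ∀ {k j} → EqClosure (Linked π τ) k j → weight k ≈ weight j
        path-weights = gfold isEquivalence weight linked-weights

      -- Edges: automorphisms differing on a single class

      module _ {j₀ : Fin n} (differ : to π j₀ ≢ to τ j₀)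
               (linked : ∀ j → to π j ≢ to τ j → EqClosure (Linked π τ) j₀ j) where

        endpoints : Vector (Matrix ℝ n) 2
        endpoints 0F = permutationMatrix π
        endpoints 1F = permutationMatrix τ

        -- The weight at `j₀` serves every column where `π` and `τ` differ. In the other columns
        -- both matrices coincide, so any weight gives the same column.
        spanned : ∀ {Z} → points ℝ face Z → AffineHull ℝ endpoints Z
        spanned {Z} Z∈F = w , Σw≈1 , λ i j → trans (Z≈ i j) (+-congˡ (sym (+-identityʳ _)))
          where
          x : Carrier
          x = weight Z∈F j₀

          w : Vector Carrier 2
          w 0F = 1# + - x
          w 1F = x

          Σw≈1 : sum w ≈ 1#
          Σw≈1 = begin
            1# + - x + (x + 0#) ≈⟨ +-congˡ (+-identityʳ x) ⟩
            1# + - x + x        ≈⟨ +-cong (*-identityʳ _) (*-identityʳ _) ⟨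
            (1# + - x) * 1# + x * 1# ≈⟨ affine x 1# ⟩
            1# ∎

          Z≈ : ∀ i j → Z i j ≈ (1# + - x) * permutationMatrix π i j + x * permutationMatrix τ i j
          Z≈ i j with to π j ≟ to τ j
          ... | no ne = trans (entries Z∈F i j)
            (+-cong (*-congʳ (+-congˡ (-‿cong y≈x))) (*-congʳ y≈x))
            where
            y≈x : weight Z∈F j ≈ x
            y≈x = sym (path-weights Z∈F (linked j ne))
          ... | yes eq = begin
            Z i j                                                   ≈⟨ entries Z∈F i j ⟩
            (1# + - y) * δ i (to π j) + y * δ i (to τ j)            ≡⟨ merge y ⟩
            (1# + - y) * δ i (to π j) + y * δ i (to π j)            ≈⟨ affine y _ ⟩
            δ i (to π j)                                            ≈⟨ affine x _ ⟨
            (1# + - x) * δ i (to π j) + x * δ i (to π j)            ≡⟨ merge x ⟨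
            (1# + - x) * δ i (to π j) + x * δ i (to τ j)            ∎
            where
            y = weight Z∈F j
            merge : ∀ z → (1# + - z) * δ i (to π j) + z * δ i (to τ j) ≡
                          (1# + - z) * δ i (to π j) + z * δ i (to π j)
            merge z = ≡.cong (λ t → (1# + - z) * δ i (to π j) + z * δ i t) (≡.sym eq)

        -- In column `j₀` the two ones sit in different rows, and each of these rows isolates one
        -- coefficient.
        independent : AffinelyIndependent ℝ endpoints
        independent w _ w≈0 = λ where
          0F → begin
            w 0F                                    ≈⟨ +-identityʳ _ ⟨
            w 0F + 0#                               ≈⟨ +-cong (*-identityʳ _) (+-identityʳ 0#) ⟨
            w 0F * 1# + (0# + 0#)
              ≈⟨ +-cong (*-congˡ (δ-equal {i = to π j₀} ≡.refl)) (+-congʳ (trans (*-congˡ (δ-distinct differ)) (zeroʳ _))) ⟨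
            combination ℝ w endpoints (to π j₀) j₀  ≈⟨ w≈0 (to π j₀) j₀ ⟩
            0#                                      ∎
          1F → begin
            w 1F                                    ≈⟨ +-identityˡ _ ⟨
            0# + w 1F                               ≈⟨ +-congˡ (trans (+-identityʳ _) (*-identityʳ _)) ⟨
            0# + (w 1F * 1# + 0#)
              ≈⟨ +-cong (trans (*-congˡ (δ-distinct (differ ∘ ≡.sym))) (zeroʳ _)) (+-congʳ (*-congˡ (δ-equal {i = to τ j₀} ≡.refl))) ⟨
            combination ℝ w endpoints (to τ j₀) j₀  ≈⟨ w≈0 (to τ j₀) j₀ ⟩
            0#                                      ∎

        isEdge : IsEdge ℝ P (permutationMatrix π) (permutationMatrix τ)
        isEdge = distinct , face ,
          (endpoints , (λ { 0F → face-left ; 1F → face-right }) , independent , spanned) ,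
          face-left , face-right
          where
          distinct : ¬ EqualMatrices ℝ (permutationMatrix π) (permutationMatrix τ)
          distinct eq = 1≉0 (trans (sym (δ-equal {i = to π j₀} ≡.refl))
            (trans (eq (to π j₀) j₀) (δ-distinct differ)))

    -- The face spanned by `π` with itself is supported on the entries of `π` and is a single point.
    permutationMatrix-isVertex : ∀ π → IsVertex ℝ P (permutationMatrix π)
    permutationMatrix-isVertex π = face ,
      ((λ _ → permutationMatrix π) , (λ _ → face-left) , independent , spanned) , face-left
      where
      open Span π π using (face; face-left; entries)

      independent : AffinelyIndependent ℝ {k = 1} (λ _ → permutationMatrix π)
      independent w Σw≈0 _ 0F = trans (sym (+-identityʳ _)) Σw≈0

      spanned : ∀ {Z} → points ℝ face Z → AffineHull ℝ {k = 1} (λ _ → permutationMatrix π) Z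
      spanned Z∈F = (λ _ → 1#) , +-identityʳ 1# , λ i j → trans (entries Z∈F i j)
        (trans (affine _ _) (sym (trans (+-identityʳ _) (*-identityˡ _))))

    -- Paths between integral vertices

    private
      H = induced (skeleton ℝ P) (λ X → IsIntegral ℝ (proj₁ X))

      Path : Rel (Graph.Vertex H) _
      Path = Star (λ u w → Graph._≈_ H u w ⊎ Graph.Edge H u w)

    vertex : Automorphism G → Graph.Vertex H
    vertex π = (permutationMatrix π , permutationMatrix-isVertex π) , permutationMatrix-integral π

    -- `C` collects columns where `π` already agrees with `τ`. An exchange keeps them and adds `j₀`,
    -- so the subset grows strictly and the recursion ends.
    path : ∀ (τ π : Automorphism G) (C : Subset n) → Acc _⊃_ C →
           (∀ {j} → j ∈ C → to π j ≡ to τ j) → Path (vertex π) (vertex τ)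
    path τ π C (acc rec) agree with any? (λ j → ¬? (to π j ≟ to τ j))
    ... | no same = inj₁ (λ i j → reflexive (≡.cong (δ i)
            (decidable-stable (_ ≟ _) (λ ne → same (j , ne))))) ◅ ε
    ... | yes (j₀ , differ) =
        -- `j₀` lies in its own class by the empty path, so the exchange does change `π` there.
        inj₂ (Span.isEdge π exchanged
          (λ eq → differ (≡.trans eq (exch-in ε))) differ⇒linked) ◅
        path τ exchanged (C ∪ ⁅ j₀ ⁆) (rec (∉⇒⊂∪⁅⁆ (differ ∘ agree)))
          (∈∪⁅⁆-elim C (λ j → exch j ≡ to τ j) (exch-agrees ∘ agree) (exch-in ε))
      where open Exchange π τ j₀

    -- An integral vertex equals a permutation matrix only entrywise, so the path begins and ends
    -- with an equality step.
    connected : ∀ x y → Path x y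
    connected ((_ , _ , _ , X∈F) , X-int) ((_ , _ , _ , Y∈F) , Y-int)
      with integral⇒automorphism (proj₁ X∈F) X-int | integral⇒automorphism (proj₁ Y∈F) Y-int
    ... | π , X≈π | τ , Y≈τ = inj₁ X≈π ◅
      (path τ π ⊥ (⊃-wellFounded _) (λ j∈⊥ → contradiction j∈⊥ ∉⊥) ◅◅
       inj₁ (λ i j → sym (Y≈τ i j)) ◅ ε)

proposition4p1 : ∀ {c ℓ₁ ℓ₂} (ℝ : RealNumbers c ℓ₁ ℓ₂) (n : ℕ) (G : SimpleGraph n) →
    QuasiIntegral ℝ (CommutingPolytope ℝ G)
-- The identity matrix shows that the graph is nonempty.
proposition4p1 ℝ n G = vertex ℝ (identity {G = G}) , connected ℝ
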